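{- For every fixed edge-ordered graph $G$ with at least one edge, $ssat_e(n,G)=O(n\log n)$.
   Context: An edge-ordered graph is a finite simple graph together with a linear order on its edge set (usually given by an injective labeling $l:E\to\mathbb{N}$ or $l:E\to\mathbb{R}$). A copy of $G$ in an edge-ordered graph $H$ is a subgraph of $H$ (with the induced edge-order) isomorphic to $G$ by an isomorphism respecting the edge-order. $ssat_e(n,G)$ is the minimum number of edges in an edge-ordered graph $H$ on $n$ vertices (not required to be $G$-free) such that adding to $H$ any missing edge, inserted at an arbitrary position of the linear order of the edges, creates a new copy of $G$ (one using the added edge); that is, for every missing edge and every position a new copy is created. Asymptotic notation is for $n\to\infty$ with $G$ fixed; the implied constant may depend on $G$. -}

module Defs where

open import Data.Fin.Base using (Fin; zero; suc; _<_; finToFun; funToFin)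
open import Data.Fin.Properties as Fin using (finToFun-funToFin)
open import Data.List.Base
  using (List; []; _∷_; length; insertAt; deduplicate; cartesianProductWith; concatMap; allFin)
import Data.List.Membership.DecPropositional as DecMembership
open import Data.List.Membership.Propositional using (_∈_; _∉_; lose; find)
open import Data.List.Membership.Propositional.Properties
  using (∈-allFin; ∈-concatMap⁺; ∈-cartesianProductWith⁺; ∈-deduplicate⁺)
open import Data.List.Relation.Binary.Sublist.Heterogeneous as Sublist using (Sublist)
open import Data.List.Relation.Binary.Sublist.Heterogeneous.Properties using (sublist?)
open import Data.List.Relation.Unary.All as All using (All; []; _∷_)
open import Data.List.Relation.Unary.All.Properties using (¬Any⇒All¬)
open import Data.List.Relation.Unary.Any as Any using (Any; here; there)
open import Data.List.Relation.Unary.Unique.DecPropositional using (unique?)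
open import Data.List.Relation.Unary.Unique.DecPropositional.Properties using (deduplicate-!)
open import Data.List.Relation.Unary.Unique.Propositional using (Unique; []; _∷_)
open import Data.Nat.Base using (ℕ; zero; suc; _≤_; _≥_; _*_; z≤n; s≤s)
import Data.Nat.Properties as ℕ
open import Data.Product using (Σ; ∃; ∃-syntax; _×_; _,_; proj₁; proj₂)
open import Data.Sum.Base using (_⊎_; inj₁; inj₂)
open import Function.Base using (_∘_)
open import Function.Definitions using (Injective)
open import Relation.Binary.Definitions using (DecidableEquality)
open import Relation.Binary.PropositionalEquality
  using (_≡_; refl; sym; trans; _≗_)
open import Relation.Nullary using (Dec; yes; no; contradiction; contradiction-irr)
open import Relation.Nullary.Decidable using (map′; _×-dec_; _⊎-dec_; _→-dec_)
open import Relation.Unary using (Decidable)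

private
  variable
    m n : ℕ

-- An unordered pair of distinct vertices, stored with its smaller end first.
record Edge (n : ℕ) : Set where
  constructor edge
  field
    lo hi  : Fin n
    .lo<hi : lo < hi

open Edge public

-- A finite simple graph on the vertex set Fin n with a linear order on its
-- edge set: the edges are listed without repetition in increasing order.
record EdgeOrderedGraph (n : ℕ) : Set where
  field
    edges  : List (Edge n)
    unique : Unique edges

open EdgeOrderedGraph public

edgeCount : EdgeOrderedGraph n → ℕ
edgeCount H = length (edges H)

MapsEdge : (Fin m → Fin n) → Edge m → Edge n → Set
MapsEdge f d e = (f (lo d) ≡ lo e × f (hi d) ≡ hi e)
               ⊎ (f (lo d) ≡ hi e × f (hi d) ≡ lo e)

-- A copy is given by an isomorphism of G onto a subgraph of H.  As edges are
-- listed in increasing order, the edge map is order preserving exactly when it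
-- presents the edge list of G as a (not necessarily contiguous) sublist of
-- that of H.
record Copy (G : EdgeOrderedGraph m) (H : EdgeOrderedGraph n) : Set where
  field
    vertexMap : Fin m → Fin n
    injective : Injective _≡_ _≡_ vertexMap
    embedding : Sublist (MapsEdge vertexMap) (edges G) (edges H)

open Copy public

Uses : {G : EdgeOrderedGraph m} {H : EdgeOrderedGraph n} → Copy G H → Edge n → Set
Uses {G = G} c e = Any (λ d → MapsEdge (vertexMap c) d e) (edges G)

NewCopy : EdgeOrderedGraph m → EdgeOrderedGraph n → Edge n → Set
NewCopy G H e = Σ (Copy G H) λ c → Uses c e

private
  insertAt-All : ∀ {a p} {A : Set a} {P : A → Set p} {xs : List A} {x} i →
                 P x → All P xs → All P (insertAt xs i x)
  insertAt-All zero    px pxs        = px ∷ pxs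
  insertAt-All (suc i) px (py ∷ pxs) = py ∷ insertAt-All i px pxs

insertAt-unique : ∀ {a} {A : Set a} {xs : List A} {x} i →
                  x ∉ xs → Unique xs → Unique (insertAt xs i x)
insertAt-unique zero    x∉xs u         = ¬Any⇒All¬ _ x∉xs ∷ u
insertAt-unique (suc i) x∉xs (y∉ys ∷ u) =
  insertAt-All i (x∉xs ∘ here ∘ sym) y∉ys ∷ insertAt-unique i (x∉xs ∘ there) u

-- The edge e becomes the i-th smallest edge (counting from zero).
addEdge : (H : EdgeOrderedGraph n) (e : Edge n) → e ∉ edges H →
          Fin (suc (edgeCount H)) → EdgeOrderedGraph n
addEdge H e e∉H i = record
  { edges  = insertAt (edges H) i e
  ; unique = insertAt-unique i e∉H (unique H)
  }

Semisaturated : EdgeOrderedGraph m → EdgeOrderedGraph n → Set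
Semisaturated G H = ∀ e (e∉H : e ∉ edges H) i → NewCopy G (addEdge H e e∉H i) e

SemisaturatedWith : ∀ n → EdgeOrderedGraph m → ℕ → Set
SemisaturatedWith n G k = Σ (EdgeOrderedGraph n) λ H → Semisaturated G H × edgeCount H ≡ k

IsLeast : (ℕ → Set) → ℕ → Set
IsLeast P k = P k × (∀ j → P j → k ≤ j)

-- The minimum defining ssat exists: the complete graph is vacuously
-- semisaturated, and the property is decidable.
private
  _≟ᴱ_ : DecidableEquality (Edge n)
  edge a b _ ≟ᴱ edge c d _ =
    map′ (λ { (refl , refl) → refl }) (λ { refl → refl , refl }) ((a Fin.≟ c) ×-dec (b Fin.≟ d))

  edgeOf : Fin n → Fin n → List (Edge n)
  edgeOf u v with u Fin.<? v
  ... | yes u<v = edge u v u<v ∷ []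
  ... | no  _   = []

  ∈-edgeOf : (e : Edge n) → e ∈ edgeOf (lo e) (hi e)
  ∈-edgeOf (edge u v u<v) with u Fin.<? v
  ... | yes _   = here refl
  ... | no  u≮v = contradiction-irr u<v u≮v

  allEdges : ∀ n → List (Edge n)
  allEdges n = concatMap (λ u → concatMap (edgeOf u) (allFin n)) (allFin n)

  ∈-allEdges : (e : Edge n) → e ∈ allEdges n
  ∈-allEdges {n} e =
    ∈-concatMap⁺ (λ u → concatMap (edgeOf u) (allFin n))
      (lose (∈-allFin (lo e))
        (∈-concatMap⁺ (edgeOf (lo e)) (lose (∈-allFin (hi e)) (∈-edgeOf e))))

  complete : ∀ n → EdgeOrderedGraph n
  complete n = record
    { edges  = deduplicate _≟ᴱ_ (allEdges n)
    ; unique = deduplicate-! _≟ᴱ_ (allEdges n)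
    }

  complete-semisaturated : (G : EdgeOrderedGraph m) → Semisaturated G (complete n)
  complete-semisaturated G e e∉H =
    contradiction (∈-deduplicate⁺ _≟ᴱ_ (∈-allEdges e)) e∉H

  mapsEdge? : (f : Fin m → Fin n) → ∀ d e → Dec (MapsEdge f d e)
  mapsEdge? f d e = ((f (lo d) Fin.≟ lo e) ×-dec (f (hi d) Fin.≟ hi e))
              ⊎-dec ((f (lo d) Fin.≟ hi e) ×-dec (f (hi d) Fin.≟ lo e))

  MapsEdge-cong : {f g : Fin m → Fin n} → f ≗ g → ∀ {d} {e} → MapsEdge f d e → MapsEdge g d e
  MapsEdge-cong f≗g (inj₁ (p , q)) = inj₁ (trans (sym (f≗g _)) p , trans (sym (f≗g _)) q)
  MapsEdge-cong f≗g (inj₂ (p , q)) = inj₂ (trans (sym (f≗g _)) p , trans (sym (f≗g _)) q)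

  injective? : (f : Fin m → Fin n) → Dec (Injective _≡_ _≡_ f)
  injective? f = map′ (λ h {x} {y} → h x y) (λ h x y → h)
    (Fin.all? λ x → Fin.all? λ y → (f x Fin.≟ f y) →-dec (x Fin.≟ y))

  newCopy? : (G : EdgeOrderedGraph m) (H : EdgeOrderedGraph n) (e : Edge n) →
             Dec (NewCopy G H e)
  newCopy? {m} {n} G H e = map′ to from (Fin.any? λ j → dec (finToFun j))
    where
    P : (Fin m → Fin n) → Set
    P f = Injective _≡_ _≡_ f × Sublist (MapsEdge f) (edges G) (edges H)
        × Any (λ d → MapsEdge f d e) (edges G)

    dec : ∀ f → Dec (P f)
    dec f = injective? f ×-dec sublist? (mapsEdge? f) (edges G) (edges H)
            ×-dec Any.any? (λ d → mapsEdge? f d e) (edges G)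

    to : (∃[ j ] P (finToFun j)) → NewCopy G H e
    to (j , inj , sub , use) =
      record { vertexMap = finToFun j ; injective = inj ; embedding = sub } , use

    from : NewCopy G H e → ∃[ j ] P (finToFun j)
    from (c , use) = funToFin f , inj , Sublist.map (λ {d} {e} → MapsEdge-cong f≗g {d} {e}) (embedding c)
                   , Any.map (λ {d} → MapsEdge-cong f≗g {d} {e}) use
      where
      f : Fin m → Fin n
      f = vertexMap c
      f≗g : f ≗ finToFun (funToFin f)
      f≗g x = sym (finToFun-funToFin f x)
      inj : Injective _≡_ _≡_ (finToFun (funToFin f))
      inj {x} {y} p = injective c (trans (f≗g x) (trans p (sym (f≗g y))))

  semisaturated? : (G : EdgeOrderedGraph m) (H : EdgeOrderedGraph n) → Dec (Semisaturated G H)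
  semisaturated? {n = n} G H =
    map′ (λ h e → All.lookup h (∈-allEdges e)) (λ h → All.tabulate λ {e} _ → h e)
         (All.all? dec (allEdges n))
    where
    dec : ∀ e → Dec (∀ (e∉H : e ∉ edges H) i → NewCopy G (addEdge H e e∉H i) e)
    dec e with DecMembership._∈?_ _≟ᴱ_ e (edges H)
    ... | yes e∈H = yes λ e∉H → contradiction e∈H e∉H
    ... | no  e∉H = map′ (λ h e∉H′ i → rebuild (h i)) (λ h → h e∉H)
                         (Fin.all? λ i → newCopy? G (addEdge H e e∉H i) e)
      where
      rebuild : ∀ {i e∉H′} → NewCopy G (addEdge H e e∉H i) e →
                NewCopy G (addEdge H e e∉H′ i) e
      rebuild (c , use) = record
        { vertexMap = vertexMap c ; injective = injective c ; embedding = embedding c } , use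

  edgeLists : ∀ n → ℕ → List (List (Edge n))
  edgeLists n zero    = [] ∷ []
  edgeLists n (suc k) = cartesianProductWith _∷_ (allEdges n) (edgeLists n k)

  ∈-edgeLists : (es : List (Edge n)) → es ∈ edgeLists n (length es)
  ∈-edgeLists []       = here refl
  ∈-edgeLists (e ∷ es) = ∈-cartesianProductWith⁺ _∷_ (∈-allEdges e) (∈-edgeLists es)

  semisaturatedWith? : ∀ n (G : EdgeOrderedGraph m) → Decidable (SemisaturatedWith n G)
  semisaturatedWith? n G k = map′ to from (Any.any? dec (edgeLists n k))
    where
    P : List (Edge n) → Set
    P es = Σ (Unique es) λ u →
           Semisaturated G (record { edges = es ; unique = u }) × length es ≡ k

    dec : ∀ es → Dec (P es)
    dec es with unique? _≟ᴱ_ es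
    ... | no ¬u = no (¬u ∘ proj₁)
    ... | yes u = map′ (u ,_) (λ (_ , s , p) → (λ e e∉H i → rebuild (s e e∉H i)) , p)
                       (semisaturated? G H ×-dec (length es ℕ.≟ k))
      where
      H : EdgeOrderedGraph n
      H = record { edges = es ; unique = u }
      rebuild : ∀ {u′ e i e∉H} →
        NewCopy G (addEdge (record { edges = es ; unique = u′ }) e e∉H i) e →
        NewCopy G (addEdge H e e∉H i) e
      rebuild (c , use) = record
        { vertexMap = vertexMap c ; injective = injective c ; embedding = embedding c } , use

    to : Any P (edgeLists n k) → SemisaturatedWith n G k
    to h with es , _ , u , s , p ← find h = record { edges = es ; unique = u } , s , p

    from : SemisaturatedWith n G k → Any P (edgeLists n k)
    from (H , s , refl) = lose (∈-edgeLists (edges H)) (unique H , s , refl)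

  least : {P : ℕ → Set} → Decidable P → ∀ k → P k → ∃ (IsLeast P)
  least P? k pk with P? 0
  least P? k       pk | yes p0 = 0 , p0 , λ _ _ → z≤n
  least P? zero    pk | no ¬p0 = contradiction pk ¬p0
  least P? (suc k) pk | no ¬p0 with j , pj , min ← least (P? ∘ suc) k pk =
    suc j , pj , λ { zero p0 → contradiction p0 ¬p0 ; (suc i) pi → s≤s (min i pi) }

abstract
  minimum-exists : ∀ n (G : EdgeOrderedGraph m) → ∃ (IsLeast (SemisaturatedWith n G))
  minimum-exists n G = least (semisaturatedWith? n G)
    (edgeCount (complete n)) (complete n , complete-semisaturated G , refl)

ssat : ∀ n → EdgeOrderedGraph m → ℕ
ssat n G = proj₁ (minimum-exists n G)

ssat-isLeast : ∀ n (G : EdgeOrderedGraph m) → IsLeast (SemisaturatedWith n G) (ssat n G)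
ssat-isLeast n G = proj₂ (minimum-exists n G)

_=O_ : (ℕ → ℕ) → (ℕ → ℕ) → Set
f =O g = ∃[ C ] ∃[ N ] (∀ n → n ≥ N → f n ≤ C * g n)

{-# OPTIONS --safe #-}
-- H consists of all edges meeting a core of 2 L m vertices, where 2 ^ L ≥ n.
-- The core is made of gadgets (s , j), each a copy of the vertex set of G, with
-- s a side and j < L.  Side 0 comes early in the edge order and waits for the
-- new edge to play the last edge of G; side 1 comes late and waits for it to
-- play the first edge of G.  Whatever the position of the new edge, either all
-- of side 0 precedes it or all of side 1 follows it.  The vertices outside the
-- core carry distinct binary codes of length L, and in the gadgets (s , j) the
-- j-th bit of u decides which end of the distinguished edge u plays; the edges
-- between u and the gadget are ordered accordingly.  Two vertices u and v
-- differ in some bit j, so that uv and a gadget (s , j) together form a copy.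
module Submission where

open import Defs
open import Data.Fin.Base
  using (Fin; zero; suc; toℕ; _↑ˡ_; _↑ʳ_; splitAt; combine; remQuot; finToFun; funToFin; inject≤)
  renaming (_<_ to _<ᶠ_)
open import Data.Fin.Properties as Fin
  using (splitAt-↑ˡ; splitAt-↑ʳ; splitAt⁻¹-↑ˡ; splitAt⁻¹-↑ʳ; remQuot-combine; funToFin-finToFin;
         inject≤-injective; ¬∀⟶∃¬)
open import Data.List.Base
  using (List; []; _∷_; _++_; length; map; take; drop; insertAt; deduplicate; catMaybes;
         cartesianProductWith; allFin; InitLast; _∷ʳ′_; initLast)
open import Data.List.Properties
  using (take++drop≡id; length-deduplicate; length-catMaybes; length-map; length-++; length-tabulate)
open import Data.List.Membership.Propositional using (_∈_; _∉_; lose)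
open import Data.List.Membership.Propositional.Properties
  using (∈-allFin; ∈-map⁺; ∈-cartesianProductWith⁺; ∈-deduplicate⁺)
open import Data.List.Relation.Binary.Permutation.Propositional using (↭-sym; ↭⇒↭ₛ)
open import Data.List.Relation.Binary.Permutation.Propositional.Properties using (∈-resp-↭; ↭-length)
import Data.List.Relation.Binary.Permutation.Setoid.Properties as Permutationₛ
open import Data.List.Relation.Binary.Sublist.Heterogeneous using (Sublist; []; _∷_; _∷ʳ_; minimum)
open import Data.List.Relation.Binary.Sublist.Heterogeneous.Properties using (++⁺)
open import Data.List.Relation.Unary.All as All using (All; []; _∷_)
import Data.List.Relation.Unary.All.Properties as All
open import Data.List.Relation.Unary.AllPairs as AllPairs using (AllPairs; []; _∷_)
import Data.List.Relation.Unary.AllPairs.Properties as AllPairs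
open import Data.List.Relation.Unary.Any as Any using (Any; here; there)
import Data.List.Relation.Unary.Any.Properties as Any
open import Data.List.Relation.Unary.Linked.Properties using (Linked⇒AllPairs)
open import Data.List.Relation.Unary.Unique.DecPropositional.Properties using (deduplicate-!)
open import Data.List.Relation.Unary.Unique.Propositional using (Unique)
import Data.List.Sort as Sort
open import Data.Maybe.Base using (Maybe; just; nothing; maybe′; _<∣>_)
open import Data.Nat.Base using (ℕ; zero; suc; _+_; _*_; _^_; _≤_; _<_; _≥_; z<s; s<s)
open import Data.Nat.Logarithm using (⌊log₂_⌋; ⌊log₂⌋-mono-≤; ⌊log₂[2^n]⌋≡n)
import Data.Nat.Properties as ℕ
open import Data.Nat.Tactic.RingSolver using (solve-∀)
open import Data.Product using (Σ; ∃-syntax; _×_; _,_; proj₁; proj₂)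
open import Data.Sum.Base using (_⊎_; inj₁; inj₂; [_,_]′)
open import Function.Base using (_∘_; id)
open import Function.Definitions using (Injective)
open import Level using (0ℓ)
open import Relation.Binary.Core using (Rel)
open import Relation.Binary.Definitions using (DecidableEquality; tri<; tri≈; tri>)
import Relation.Binary.Construct.On as On
open import Relation.Binary.PropositionalEquality
  using (_≡_; _≢_; refl; sym; trans; cong; cong₂; subst; subst₂; setoid; module ≡-Reasoning)
open import Relation.Nullary using (Dec; yes; no; contradiction)
open import Relation.Nullary.Decidable using (map′; recompute; _×-dec_; _⊎-dec_)

private
  variable
    m n : ℕ
    A B : Set

-- Auxiliary facts about lists.

module _ {R : Rel A 0ℓ} where

  AllPairs-++⁻ : ∀ xs {ys} → AllPairs R (xs ++ ys) →
                 AllPairs R xs × All (λ x → All (R x) ys) xs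
  AllPairs-++⁻ []       _          = [] , []
  AllPairs-++⁻ (x ∷ xs) (rx ∷ rxs) =
    let rs , cross = AllPairs-++⁻ xs rxs
    in All.++⁻ˡ xs rx ∷ rs , All.++⁻ʳ xs rx ∷ cross

insertAt-take-drop : ∀ (xs : List A) i x →
                     insertAt xs i x ≡ take (toℕ i) xs ++ x ∷ drop (toℕ i) xs
insertAt-take-drop xs       zero    x = refl
insertAt-take-drop (y ∷ xs) (suc i) x = cong (y ∷_) (insertAt-take-drop xs i x)

Any-take-drop : ∀ {P : A → Set} i xs → Any P xs → Any P (take i xs) ⊎ Any P (drop i xs)
Any-take-drop i xs p = Any.++⁻ (take i xs) (subst (Any _) (sym (take++drop≡id i xs)) p)

length-cartesianProductWith : ∀ {C : Set} (f : A → B → C) xs ys →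
                              length (cartesianProductWith f xs ys) ≡ length xs * length ys
length-cartesianProductWith f []       ys = refl
length-cartesianProductWith f (x ∷ xs) ys = trans
  (length-++ (map (f x) ys))
  (cong₂ _+_ (length-map (f x) ys) (length-cartesianProductWith f xs ys))

∈-catMaybes⁺ : ∀ {x : A} {xs} → just x ∈ xs → x ∈ catMaybes xs
∈-catMaybes⁺ {xs = just _  ∷ xs} (here refl) = here refl
∈-catMaybes⁺ {xs = just _  ∷ xs} (there p)   = there (∈-catMaybes⁺ p)
∈-catMaybes⁺ {xs = nothing ∷ xs} (there p)   = ∈-catMaybes⁺ p

-- Lists sorted by a numerical key.

module _ (key : B → ℕ) where

  Increasing : List B → Set
  Increasing = AllPairs (λ x y → key x ≤ key y)

  -- By sortedness everything after an element of key at least `t` also has key at least `t`. If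
  -- such an element lies before the cut, the whole suffix is therefore high; otherwise the whole
  -- prefix is low.
  increasing-cut : ∀ t i {xs} → Increasing xs →
                   All (λ x → key x < t) (take i xs) ⊎ All (λ x → t ≤ key x) (drop i xs)
  increasing-cut t zero    _        = inj₁ []
  increasing-cut t (suc i) []       = inj₁ []
  increasing-cut t (suc i) {x ∷ xs} (x≤ ∷ inc) with t ℕ.≤? key x
  ... | yes t≤x = inj₂ (All.drop⁺ i (All.map (ℕ.≤-trans t≤x) x≤))
  ... | no  t≰x with increasing-cut t i inc
  ...   | inj₁ p = inj₁ (ℕ.≰⇒> t≰x ∷ p)
  ...   | inj₂ p = inj₂ p

  All-at-key : ∀ (P : ℕ → Set) {Q : B → Set} {t xs} → All (P ∘ key) xs →
               Any (λ x → Q x × key x ≡ t) xs → P t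
  All-at-key P = All.lookupWith (λ px (_ , x≡t) → subst P x≡t px)

  -- The witnesses are found independently of one another, but since the `κ a` increase strictly,
  -- their keys force them to be distinct and to occur in the right order, whatever ties `xs` has.
  increasing-sublist : ∀ {R : A → B → Set} {κ : A → ℕ} {as xs} → Increasing xs →
                       AllPairs (λ a b → κ a < κ b) as →
                       All (λ a → Any (λ x → R a x × key x ≡ κ a) xs) as →
                       Sublist R as xs
  increasing-sublist {xs = xs}     _          []           []             = minimum xs
  increasing-sublist {xs = x ∷ xs} (x≤ ∷ inc) (a< ∷ asc) (here (r , x≡a) ∷ ps) =
    r ∷ increasing-sublist inc asc
          (All.zipWith (λ (a<b , p) → Any.tail (λ (_ , x≡b) → ℕ.<⇒≢ a<b (trans (sym x≡a) x≡b)) p) (a< , ps))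
  increasing-sublist {xs = x ∷ xs} (x≤ ∷ inc) (a< ∷ asc) (there p ∷ ps) =
    x ∷ʳ increasing-sublist inc (a< ∷ asc)
           (p ∷ All.zipWith (λ (a<b , q) → Any.tail
             (λ (_ , x≡b) → ℕ.<⇒≢ (ℕ.≤-<-trans x≤a a<b) x≡b) q) (a< , ps))
    where
    -- The witness of `a` lies further on, so the skipped head has key at most `κ a` and cannot be
    -- the witness of a later `b`.
    x≤a = All.lookupWith (λ x≤y (_ , y≡a) → subst (key x ≤_) y≡a x≤y) x≤ p

-- Edges and their unordered pairs of ends.

Ends : Fin n → Fin n → Edge n → Set
Ends p q e = (p ≡ lo e × q ≡ hi e) ⊎ (p ≡ hi e × q ≡ lo e)

ends? : (p q : Fin n) (e : Edge n) → Dec (Ends p q e)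
ends? p q e = ((p Fin.≟ lo e) ×-dec (q Fin.≟ hi e)) ⊎-dec ((p Fin.≟ hi e) ×-dec (q Fin.≟ lo e))

ends-sym : ∀ {p q} {e : Edge n} → Ends p q e → Ends q p e
ends-sym (inj₁ (r , s)) = inj₂ (s , r)
ends-sym (inj₂ (r , s)) = inj₁ (s , r)

lo<hi-relevant : (e : Edge n) → lo e <ᶠ hi e
lo<hi-relevant (edge a b a<b) = recompute (a Fin.<? b) a<b

ends-unique : ∀ {p q} {d e : Edge n} → Ends p q d → Ends p q e → d ≡ e
ends-unique (inj₁ (refl , refl)) (inj₁ (refl , refl)) = refl
ends-unique (inj₂ (refl , refl)) (inj₂ (refl , refl)) = refl
-- Opposite orientations would reverse the order of `lo` and `hi` in one of the two edges.
ends-unique {d = d} {e} (inj₁ (refl , refl)) (inj₂ (d≡ , e≡)) =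
  contradiction (lo<hi-relevant d) (Fin.<-asym (subst₂ _<ᶠ_ (sym e≡) (sym d≡) (lo<hi-relevant e)))
ends-unique {d = d} {e} (inj₂ (refl , refl)) (inj₁ (d≡ , e≡)) =
  contradiction (lo<hi-relevant d) (Fin.<-asym (subst₂ _<ᶠ_ (sym d≡) (sym e≡) (lo<hi-relevant e)))

lo≢hi : (e : Edge n) → lo e ≢ hi e
lo≢hi e eq = Fin.<-irrefl eq (lo<hi-relevant e)

_≟ᴱ_ : DecidableEquality (Edge n)
edge a b _ ≟ᴱ edge c d _ =
  map′ (λ { (refl , refl) → refl }) (λ { refl → refl , refl }) ((a Fin.≟ c) ×-dec (b Fin.≟ d))

joining : (p q : Fin n) → Maybe (Edge n)
joining p q with Fin.<-cmp p q
... | tri< p<q _ _ = just (edge p q p<q)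
... | tri≈ _ _ _   = nothing
... | tri> _ _ q<p = just (edge q p q<p)

joining-exists : ∀ {p q : Fin n} → p ≢ q → ∃[ e ] Ends p q e × joining p q ≡ just e
joining-exists {p = p} {q} p≢q with Fin.<-cmp p q
... | tri< p<q _ _ = _ , inj₁ (refl , refl) , refl
... | tri≈ _ p≡q _ = contradiction p≡q p≢q
... | tri> _ _ q<p = _ , inj₂ (refl , refl) , refl

-- A vertex paired with itself yields no edge, and an edge inside `cs` is produced from either end;
-- hence `catMaybes` and `deduplicate`.
incident : List (Fin n) → List (Edge n)
incident {n} cs = deduplicate _≟ᴱ_ (catMaybes (cartesianProductWith joining cs (allFin n)))

incident-length : (cs : List (Fin n)) → length (incident cs) ≤ length cs * n
incident-length {n} cs = begin
  length (incident cs)                        ≤⟨ length-deduplicate _≟ᴱ_ (catMaybes es) ⟩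
  length (catMaybes es)                       ≤⟨ length-catMaybes es ⟩
  length es                                   ≡⟨ length-cartesianProductWith joining cs (allFin n) ⟩
  length cs * length (allFin n)               ≡⟨ cong (length cs *_) (length-tabulate id) ⟩
  length cs * n                               ∎
  where
  open ℕ.≤-Reasoning
  es = cartesianProductWith joining cs (allFin n)

∈-incident : ∀ {cs} {p q : Fin n} {e} → p ∈ cs → Ends p q e → e ∈ incident cs
∈-incident {p = p} {q} {e} p∈cs ends with joining-exists p≢q
  where
  p≢q : p ≢ q
  p≢q p≡q = [ (λ (r , s) → lo≢hi e (trans (sym r) (trans p≡q s)))
            , (λ (r , s) → lo≢hi e (trans (sym s) (trans (sym p≡q) r))) ]′ ends
... | d , ends′ , eq with refl ← ends-unique {d = d} {e = e} ends′ ends =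
  ∈-deduplicate⁺ _≟ᴱ_ (∈-catMaybes⁺
    (subst (_∈ _) eq (∈-cartesianProductWith⁺ joining p∈cs (∈-allFin q))))

-- Ranks of vertex pairs in an ordered edge list.

rank : List (Edge m) → Fin m → Fin m → ℕ
-- Reached when no edge of the list joins the pair, whose rank is then the length of the list, above
-- the rank of every listed edge.
rank []       a b = 0
rank (d ∷ ds) a b with ends? a b d
... | yes _ = 0
... | no  _ = suc (rank ds a b)

rank-sym : ∀ (ds : List (Edge m)) a b → rank ds a b ≡ rank ds b a
rank-sym []       a b = refl
rank-sym (d ∷ ds) a b with ends? a b d | ends? b a d
... | yes _ | yes _ = refl
... | no  _ | no  _ = cong suc (rank-sym ds a b)
... | yes p | no ¬q = contradiction (ends-sym {e = d} p) ¬q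
... | no ¬p | yes q = contradiction (ends-sym {e = d} q) ¬p

edgeRank : List (Edge m) → Edge m → ℕ
edgeRank ds d = rank ds (lo d) (hi d)

edgeRank-here : ∀ (d : Edge m) ds → edgeRank (d ∷ ds) d ≡ 0
edgeRank-here d ds with ends? (lo d) (hi d) d
... | yes _ = refl
... | no ¬p = contradiction (inj₁ (refl , refl)) ¬p

edgeRank-there : ∀ {d e : Edge m} ds → d ≢ e → edgeRank (d ∷ ds) e ≡ suc (edgeRank ds e)
edgeRank-there {d = d} {e} ds d≢e with ends? (lo e) (hi e) d
... | yes p = contradiction (ends-unique {d = d} {e = e} p (inj₁ (refl , refl))) d≢e
... | no  _ = refl

edgeRank-< : ∀ {d : Edge m} {ds} → d ∈ ds → edgeRank ds d < length ds
edgeRank-< {d = d} {e ∷ ds} d∈ with ends? (lo d) (hi d) e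
... | yes _ = z<s
edgeRank-< {d = d} {e ∷ ds} (here refl) | no ¬p = contradiction (inj₁ (refl , refl)) ¬p
edgeRank-< {d = d} {e ∷ ds} (there d∈)  | no _  = s<s (edgeRank-< d∈)

-- Without repetitions, prepending `d` gives it rank 0 and shifts every other rank up by one. This
-- turns the edge order of a graph into strictly increasing numerical keys.
edgeRank-increasing : ∀ {ds : List (Edge m)} → Unique ds →
                      AllPairs (λ d e → edgeRank ds d < edgeRank ds e) ds
edgeRank-increasing []                 = []
edgeRank-increasing {ds = d ∷ ds} (d≢ ∷ u) =
  All.map (λ d≢e → subst₂ _<_ (sym (edgeRank-here d ds)) (sym (edgeRank-there ds d≢e)) z<s) d≢
  ∷ tail d≢ (edgeRank-increasing u)
  where
  tail : ∀ {es} → All (d ≢_) es → AllPairs (λ a b → edgeRank ds a < edgeRank ds b) es →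
         AllPairs (λ a b → edgeRank (d ∷ ds) a < edgeRank (d ∷ ds) b) es
  tail []          []         = []
  tail (d≢a ∷ d≢es) (a< ∷ inc) =
    All.zipWith (λ (a<b , d≢b) →
      subst₂ _<_ (sym (edgeRank-there ds d≢a)) (sym (edgeRank-there ds d≢b)) (s<s a<b)) (a< , d≢es)
    ∷ tail d≢es inc

-- The graph `H`: core, gadgets and edge keys.

module Construction (es : List (Edge m)) (root : Fin 2 → Edge m)
                    (L r : ℕ) (code : Fin r → Fin L → Fin 2) where

  K : ℕ
  K = 2 * (L * m)

  V : Set
  V = Fin (K + r)

  core : Fin 2 → Fin L → Fin m → V
  core s j w = combine s (combine j w) ↑ˡ r

  outer : Fin r → V
  outer u = K ↑ʳ u

  regroup : Fin 2 × Fin (L * m) → (Fin 2 × Fin L) × Fin m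
  regroup (s , t) = (s , proj₁ (remQuot {L} m t)) , proj₂ (remQuot {L} m t)

  unpack : Fin K → (Fin 2 × Fin L) × Fin m
  unpack c = regroup (remQuot {2} (L * m) c)

  unpack-combine : ∀ s j w → unpack (combine s (combine j w)) ≡ ((s , j) , w)
  unpack-combine s j w = trans
    (cong regroup (remQuot-combine s (combine j w)))
    (cong (λ (j , w) → (s , j) , w) (remQuot-combine j w))

  gadget : V → Maybe (Fin 2 × Fin L)
  gadget p = [ just ∘ proj₁ ∘ unpack , (λ _ → nothing) ]′ (splitAt K p)

  endpoint : Fin 2 → Fin 2 → Fin m
  endpoint s zero    = lo (root s)
  endpoint s (suc _) = hi (root s)

  -- The vertex of `G` that `p` plays in gadget `(s , j)`. A core vertex keeps its own label `w`
  -- whichever gadget it lies in; `s` and `j` matter only outside the core.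
  role : Fin 2 → Fin L → V → Fin m
  role s j p = [ proj₂ ∘ unpack , (λ u → endpoint s (code u j)) ]′ (splitAt K p)

  gadget-core : ∀ s j w → gadget (core s j w) ≡ just (s , j)
  gadget-core s j w rewrite splitAt-↑ˡ K (combine s (combine j w)) r =
    cong (just ∘ proj₁) (unpack-combine s j w)

  gadget-outer : ∀ u → gadget (outer u) ≡ nothing
  gadget-outer u rewrite splitAt-↑ʳ K r u = refl

  role-core : ∀ s j w → role s j (core s j w) ≡ w
  role-core s j w rewrite splitAt-↑ˡ K (combine s (combine j w)) r =
    cong proj₂ (unpack-combine s j w)

  role-outer : ∀ s j u → role s j (outer u) ≡ endpoint s (code u j)
  role-outer s j u rewrite splitAt-↑ʳ K r u = refl

  -- The key intended for the image of `d` in a gadget of side `s`. Members of `es` have rank below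
  -- `length es`, so their heights are below `length es` on side 0 and at least `length es` on side
  -- 1.
  height : Fin 2 → Edge m → ℕ
  height s d = toℕ s * length es + edgeRank es d

  -- Different gadgets may share keys: a copy only ever uses one of them.  The
  -- default 0 is irrelevant, as edges outside the core are not in H.
  pairKey : V → V → ℕ
  pairKey p q = maybe′ (λ (s , j) → toℕ s * length es + rank es (role s j p) (role s j q)) 0
                       (gadget p <∣> gadget q)

  key : Edge (K + r) → ℕ
  key e = pairKey (lo e) (hi e)

  -- pairKey consults only the first end that lies in a gadget; on these pairs
  -- the choice of end does not matter.
  data Gadget (s : Fin 2) (j : Fin L) (p q : V) : Set where
    left  : gadget p ≡ just (s , j) → gadget q ≡ just (s , j) ⊎ gadget q ≡ nothing → Gadget s j p q
    right : gadget p ≡ nothing → gadget q ≡ just (s , j) → Gadget s j p q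

  pairKey-gadget : ∀ {s j p q} → Gadget s j p q →
                   pairKey p q ≡ toℕ s * length es + rank es (role s j p) (role s j q)
  pairKey-gadget (left p≡ _)   rewrite p≡ = refl
  pairKey-gadget (right p≡ q≡) rewrite p≡ | q≡ = refl

  gadget-sym : ∀ {s j p q} → Gadget s j p q → Gadget s j q p
  gadget-sym (left p≡ (inj₁ q≡)) = left q≡ (inj₁ p≡)
  gadget-sym (left p≡ (inj₂ q≡)) = right q≡ p≡
  gadget-sym (right p≡ q≡)       = left q≡ (inj₂ p≡)

  key-gadget : ∀ {s j p q e} → Gadget s j p q → Ends p q e →
               key e ≡ toℕ s * length es + rank es (role s j p) (role s j q)
  key-gadget g (inj₁ (refl , refl)) = pairKey-gadget g
  key-gadget {s} {j} {p} {q} g (inj₂ (refl , refl)) = trans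
    (pairKey-gadget (gadget-sym g))
    (cong (toℕ s * length es +_) (rank-sym es (role s j q) (role s j p)))

  -- Edges of equal key come in whatever order the sorting gives; the copies built below never use
  -- two edges of `H` with the same key.
  open Sort (On.decTotalOrder ℕ.≤-decTotalOrder key) using (sort; sort-↭; sort-↗)

  cores : List V
  cores = map (_↑ˡ r) (allFin K)

  H : EdgeOrderedGraph (K + r)
  H = record
    { edges  = sort (incident cores)
    ; unique = Permutationₛ.Unique-resp-↭ (setoid _)
                 (↭⇒↭ₛ (↭-sym (sort-↭ (incident cores))))
                 (deduplicate-! _≟ᴱ_ _)
    }

  H-increasing : Increasing key (edges H)
  H-increasing = Linked⇒AllPairs ℕ.≤-trans (sort-↗ (incident cores))

  H-edgeCount : edgeCount H ≤ K * (K + r)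
  H-edgeCount = begin
    edgeCount H               ≡⟨ ↭-length (sort-↭ (incident cores)) ⟩
    length (incident cores)   ≤⟨ incident-length cores ⟩
    length cores * (K + r)    ≡⟨ cong (_* (K + r)) (trans (length-map (_↑ˡ r) (allFin K)) (length-tabulate {n = K} id)) ⟩
    K * (K + r)               ∎
    where open ℕ.≤-Reasoning

  ∈-H : ∀ {c q e} → Ends (c ↑ˡ r) q e → e ∈ edges H
  ∈-H ends = ∈-resp-↭ (↭-sym (sort-↭ (incident cores)))
    (∈-incident (∈-map⁺ (_↑ˡ r) (∈-allFin _)) ends)

  -- Placing `G` on one gadget and two outer vertices.

  module Embedding (s : Fin 2) (j : Fin L) {a b : Fin r}
                   (a≡0 : code a j ≡ zero) (b≡1 : code b j ≡ suc zero) where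

    place : Fin m → V
    place w with w Fin.≟ lo (root s) | w Fin.≟ hi (root s)
    ... | yes _ | _     = outer a
    ... | no  _ | yes _ = outer b
    ... | no  _ | no  _ = core s j w

    place-lo : place (lo (root s)) ≡ outer a
    place-lo with lo (root s) Fin.≟ lo (root s)
    ... | yes _ = refl
    ... | no ¬p = contradiction refl ¬p

    place-hi : place (hi (root s)) ≡ outer b
    place-hi with hi (root s) Fin.≟ lo (root s) | hi (root s) Fin.≟ hi (root s)
    ... | yes p | _     = contradiction (sym p) (lo≢hi (root s))
    ... | no  _ | yes _ = refl
    ... | no  _ | no ¬p = contradiction refl ¬p

    place-cases : ∀ w → (w ≡ lo (root s) ⊎ w ≡ hi (root s)) × gadget (place w) ≡ nothing
                      ⊎ place w ≡ core s j w
    place-cases w with w Fin.≟ lo (root s) | w Fin.≟ hi (root s)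
    ... | yes p | _     = inj₁ (inj₁ p , gadget-outer a)
    ... | no  _ | yes p = inj₁ (inj₂ p , gadget-outer b)
    ... | no  _ | no  _ = inj₂ refl

    -- The bits of `a` and `b` enter here: `endpoint` sends 0 to `lo (root s)` and 1 to
    -- `hi (root s)`. The left inverse gives both the injectivity of `place` and the keys of the
    -- image edges.
    role-place : ∀ w → role s j (place w) ≡ w
    role-place w with w Fin.≟ lo (root s) | w Fin.≟ hi (root s)
    ... | yes p | _     = trans (role-outer s j a) (trans (cong (endpoint s) a≡0) (sym p))
    ... | no  _ | yes p = trans (role-outer s j b) (trans (cong (endpoint s) b≡1) (sym p))
    ... | no  _ | no  _ = role-core s j w

    place-injective : Injective _≡_ _≡_ place
    place-injective {v} {w} eq =
      trans (sym (role-place v)) (trans (cong (role s j) eq) (role-place w))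

    -- Only the two ends of `root s` are placed outside the core, and by `ends-unique` an edge with
    -- both ends among them is `root s` itself. Any other edge keeps an end in the gadget, so its
    -- image is in `H`.
    place-gadget : ∀ d → d ≢ root s →
      Gadget s j (place (lo d)) (place (hi d)) ×
      (∀ {e} → Ends (place (lo d)) (place (hi d)) e → e ∈ edges H)
    place-gadget d d≢ with place-cases (lo d) | place-cases (hi d)
    ... | inj₂ p | inj₂ q =
      left (trans (cong gadget p) (gadget-core s j _)) (inj₁ (trans (cong gadget q) (gadget-core s j _)))
      , λ {e} → ∈-H {e = e} ∘ subst (λ z → Ends z (place (hi d)) e) p
    ... | inj₂ p | inj₁ (_ , q) =
      left (trans (cong gadget p) (gadget-core s j _)) (inj₂ q)
      , λ {e} → ∈-H {e = e} ∘ subst (λ z → Ends z (place (hi d)) e) p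
    ... | inj₁ (_ , p) | inj₂ q =
      right p (trans (cong gadget q) (gadget-core s j _))
      , λ {e} → ∈-H {e = e} ∘ subst (λ z → Ends z (place (lo d)) e) q ∘ ends-sym {e = e}
    ... | inj₁ (inj₁ p , _) | inj₁ (inj₁ q , _) = contradiction (trans p (sym q)) (lo≢hi d)
    ... | inj₁ (inj₂ p , _) | inj₁ (inj₂ q , _) = contradiction (trans p (sym q)) (lo≢hi d)
    ... | inj₁ (inj₁ p , _) | inj₁ (inj₂ q , _) =
      contradiction (ends-unique {d = d} {e = root s} (inj₁ (refl , refl)) (inj₁ (p , q))) d≢
    ... | inj₁ (inj₂ p , _) | inj₁ (inj₁ q , _) =
      contradiction (ends-unique {d = d} {e = root s} (inj₁ (refl , refl)) (inj₂ (p , q))) d≢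

    place-edge : ∀ d → d ≢ root s →
                 Any (λ e → MapsEdge place d e × key e ≡ height s d) (edges H)
    place-edge d d≢ with place-gadget d d≢
    ... | g , ∈H with joining-exists (lo≢hi d ∘ place-injective)
    -- `MapsEdge place d e` unfolds to `Ends` of the two images, so `ends` proves both.
    ...   | e , ends , _ = lose (∈H {e} ends) (ends , (begin
      key e                                             ≡⟨ key-gadget {e = e} g ends ⟩
      base + rank es (role s j (place (lo d))) (role s j (place (hi d)))
                                                        ≡⟨ cong (base +_) (cong₂ (rank es) (role-place (lo d)) (role-place (hi d))) ⟩
      height s d                                        ∎))
      where
      open ≡-Reasoning
      base = toℕ s * length es

    place-root : ∀ {e} → Ends (outer a) (outer b) e → MapsEdge place (root s) e
    place-root {e} = subst₂ (λ p q → Ends p q e) (sym place-lo) (sym place-hi)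

  -- Missing edges and a bit separating their ends.

  outer-or-core : ∀ p → (∃[ c ] p ≡ c ↑ˡ r) ⊎ (∃[ u ] p ≡ outer u)
  outer-or-core p with splitAt K p in eq
  ... | inj₁ c = inj₁ (c , sym (splitAt⁻¹-↑ˡ eq))
  ... | inj₂ u = inj₂ (u , sym (splitAt⁻¹-↑ʳ eq))

  ∉-H : ∀ {e} → e ∉ edges H → ∃[ u ] ∃[ v ] u ≢ v × Ends (outer u) (outer v) e
  ∉-H {e} e∉H with outer-or-core (lo e) | outer-or-core (hi e)
  ... | inj₁ (c , p) | _            = contradiction (∈-H {e = e} (inj₁ (sym p , refl))) e∉H
  ... | inj₂ _       | inj₁ (c , q) = contradiction (∈-H {e = e} (inj₂ (sym q , refl))) e∉H
  ... | inj₂ (u , p) | inj₂ (v , q) =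
    u , v , (λ u≡v → lo≢hi e (trans p (trans (cong outer u≡v) (sym q)))) , inj₁ (sym p , sym q)

  Separating : Set
  Separating = ∀ {u v} → u ≢ v → ∃[ j ] code u j ≢ code v j

  -- `Ends` is symmetric, so the ends can be exchanged to make `a` the one with bit 0.
  separated-ends : Separating → ∀ {e u v} → u ≢ v → Ends (outer u) (outer v) e →
    ∃[ j ] ∃[ a ] ∃[ b ] code a j ≡ zero × code b j ≡ suc zero × Ends (outer a) (outer b) e
  separated-ends sep {e} {u} {v} u≢v ends with sep u≢v
  ... | j , u≢v′ with code u j in eq₁ | code v j in eq₂
  ...   | zero     | zero     = contradiction refl u≢v′
  ...   | zero     | suc zero = j , u , v , eq₁ , eq₂ , ends
  ...   | suc zero | zero     = j , v , u , eq₂ , eq₁ , ends-sym {e = e} ends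
  ...   | suc zero | suc zero = contradiction refl u≢v′

-- Semisaturation of `H` for every position of the new edge.

module _ (G : EdgeOrderedGraph m) {init rest : List (Edge m)} {last first : Edge m}
         (G≡init : edges G ≡ init ++ last ∷ []) (G≡rest : edges G ≡ first ∷ rest)
         (L r : ℕ) (code : Fin r → Fin L → Fin 2) where

  -- If `G` has a single edge, both roots are that edge and `init` and `rest` are empty.
  root : Fin 2 → Edge m
  root zero    = last
  root (suc _) = first

  open Construction (edges G) root L r code

  private
    k : ℕ
    k = edgeCount G

    _⊏_ : Edge m → Edge m → Set
    d ⊏ e = edgeRank (edges G) d < edgeRank (edges G) e

    init-⊏ : AllPairs _⊏_ init × All (λ d → All (d ⊏_) (last ∷ [])) init
    init-⊏ = AllPairs-++⁻ init (subst (AllPairs _⊏_) G≡init (edgeRank-increasing (unique G)))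

    rest-⊏ : AllPairs _⊏_ (first ∷ rest)
    rest-⊏ = subst (AllPairs _⊏_) G≡rest (edgeRank-increasing (unique G))

    ⊏⇒≢ : ∀ {d e} → d ⊏ e → d ≢ e
    ⊏⇒≢ d⊏e refl = ℕ.<-irrefl refl d⊏e

    height-mono : ∀ s {d e} → d ⊏ e → height s d < height s e
    height-mono s = ℕ.+-monoʳ-< (toℕ s * k)

    height-low : All (λ d → height zero d < k) init
    height-low = All.++⁻ˡ init (subst (All _) G≡init (All.tabulate edgeRank-<))

    height-high : ∀ d → k ≤ height (suc zero) d
    height-high d = ℕ.≤-trans (ℕ.m≤m+n k 0) (ℕ.m≤m+n (k + 0) _)

  semisaturated : Separating → Semisaturated G H
  semisaturated sep e e∉H i with ∉-H {e} e∉H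
  ... | u , v , u≢v , ends with separated-ends sep {e} u≢v ends
  -- The cut at position `i` is tested against `k`, the threshold between the heights of edges of
  -- `G` on the two sides.
  ...   | j , a , b , a≡0 , b≡1 , ends′ = copy (increasing-cut key k (toℕ i) H-increasing)
    where
    before after : List (Edge (K + r))
    before = take (toℕ i) (edges H)
    after  = drop (toℕ i) (edges H)

    module Em s = Embedding s j a≡0 b≡1

    newCopy : ∀ s {es} → edges G ≡ es → root s ∈ es →
              Sublist (MapsEdge (Em.place s)) es (before ++ e ∷ after) →
              NewCopy G (addEdge H e e∉H i) e
    newCopy s G≡es root∈es sub = record
      { vertexMap = Em.place s
      ; injective = Em.place-injective s
      ; embedding = subst₂ (Sublist (MapsEdge (Em.place s)))
                      (sym G≡es) (sym (insertAt-take-drop (edges H) i e)) sub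
      } , lose (subst (root s ∈_) (sym G≡es) root∈es) (Em.place-root s {e} ends′)

    copy : All (λ x → key x < k) before ⊎ All (λ x → k ≤ key x) after →
           NewCopy G (addEdge H e e∉H i) e
    -- The images of `rest` on side 1 have keys at least `k`, so none is in the low prefix: all
    -- follow the new edge, which plays `first`.
    copy (inj₁ low) = newCopy (suc zero) G≡rest (here refl)
      (++⁺ (minimum before) (Em.place-root (suc zero) {e} ends′ ∷ sub))
      where
      sub : Sublist (MapsEdge (Em.place (suc zero))) rest after
      sub = increasing-sublist key (AllPairs.drop⁺ (toℕ i) H-increasing)
        (AllPairs.map (λ {d} {e} → height-mono (suc zero) {d} {e}) (AllPairs.tail rest-⊏))
        (All.map (λ {d} first⊏d →
          [ (λ p → contradiction (height-high d) (ℕ.<⇒≱ (All-at-key key (_< k) low p))) , id ]′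
          (Any-take-drop (toℕ i) (edges H)
            (Em.place-edge (suc zero) d (⊏⇒≢ first⊏d ∘ sym))))
          (AllPairs.head rest-⊏))
    -- Dually, the images of `init` on side 0 have keys below `k`, so all precede the new edge,
    -- which plays `last`.
    copy (inj₂ high) = newCopy zero G≡init (Any.++⁺ʳ init (here refl))
      (++⁺ sub (Em.place-root zero {e} ends′ ∷ minimum after))
      where
      sub : Sublist (MapsEdge (Em.place zero)) init before
      sub = increasing-sublist key (AllPairs.take⁺ (toℕ i) H-increasing)
        (AllPairs.map (λ {d} {e} → height-mono zero {d} {e}) (proj₁ init-⊏))
        (All.zipWith (λ {d} (d⊏last , d<k) →
          [ id , (λ p → contradiction (All-at-key key (k ≤_) high p) (ℕ.<⇒≱ d<k)) ]′
          (Any-take-drop (toℕ i) (edges H)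
            (Em.place-edge zero d (⊏⇒≢ (All.head d⊏last)))))
          (proj₂ init-⊏ , height-low))

-- Binary codes and their length.

finToFun-injective : ∀ {m n} {i j : Fin (m ^ n)} →
                     (∀ t → finToFun {m} {n} i t ≡ finToFun j t) → i ≡ j
finToFun-injective {m} {n} {i} {j} eq = trans (sym (funToFin-finToFin {n} {m} i))
  (trans (funToFin-cong eq) (funToFin-finToFin {n} {m} j))
  where
  -- In place of function extensionality, pointwise equality is carried through the recursion of
  -- `funToFin`.
  funToFin-cong : ∀ {k} {f g : Fin k → Fin m} → (∀ t → f t ≡ g t) → funToFin f ≡ funToFin g
  funToFin-cong {zero}  f≗g = refl
  funToFin-cong {suc k} f≗g = cong₂ combine (f≗g zero) (funToFin-cong (f≗g ∘ suc))

binary : ∀ {r L} → r ≤ 2 ^ L → Fin r → Fin L → Fin 2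
binary r≤ u = finToFun (inject≤ u r≤)

-- If all bits agreed, `u` and `v` would be equal; as there are finitely many bits with decidable
-- equality, a differing one can be found.
binary-separating : ∀ {r L} (r≤ : r ≤ 2 ^ L) {u v} → u ≢ v → ∃[ j ] binary r≤ u j ≢ binary r≤ v j
binary-separating {L = L} r≤ u≢v = ¬∀⟶∃¬ L _ (λ j → _ Fin.≟ _)
  (λ eq → u≢v (inject≤-injective r≤ r≤ _ _ (finToFun-injective {n = L} eq)))

-- Were the power smaller than `n`, monotonicity of the logarithm would give
-- `suc ⌊log₂ n ⌋ ≤ ⌊log₂ n ⌋`.
n≤2^[1+⌊log₂n⌋] : ∀ n → n ≤ 2 ^ suc ⌊log₂ n ⌋
n≤2^[1+⌊log₂n⌋] n = ℕ.≮⇒≥ λ lt → ℕ.<-irrefl refl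
  (subst (_≤ ⌊log₂ n ⌋) (⌊log₂[2^n]⌋≡n (suc ⌊log₂ n ⌋)) (⌊log₂⌋-mono-≤ (ℕ.<⇒≤ lt)))

-- Complete graphs for small `n`, and the final bound.

complete : ∀ n → EdgeOrderedGraph n
complete n = record
  { edges  = incident (allFin n)
  ; unique = deduplicate-! _≟ᴱ_ _
  }

complete-semisaturated : (G : EdgeOrderedGraph m) → Semisaturated G (complete n)
complete-semisaturated G e e∉ =
  contradiction (∈-incident {e = e} (∈-allFin (lo e)) (inj₁ (refl , refl))) e∉

sparse-semisaturated : (G : EdgeOrderedGraph m) → edgeCount G ≥ 1 → ∀ n L → n ≤ 2 ^ L →
  Σ (EdgeOrderedGraph n) λ H → Semisaturated G H × edgeCount H ≤ 2 * (L * m) * n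
sparse-semisaturated {m} G G≥1 n L n≤ with 2 * (L * m) ℕ.≤? n
-- The core does not fit into `n` vertices, but then `n ≤ 2 * (L * m)`, so the complete graph with
-- its at most `n * n` edges meets the bound.
... | no K≰n = complete n , complete-semisaturated G , (begin
      edgeCount (complete n)     ≤⟨ incident-length (allFin n) ⟩
      length (allFin n) * n      ≡⟨ cong (_* n) (length-tabulate {n = n} id) ⟩
      n * n                      ≤⟨ ℕ.*-monoˡ-≤ n (ℕ.≰⇒≥ K≰n) ⟩
      2 * (L * m) * n            ∎)
  where open ℕ.≤-Reasoning
... | yes K≤n with ℕ.m≤n⇒∃[o]m+o≡n K≤n
...   | r , refl = go (edges G) refl (initLast (edges G))
  where
  r≤ : r ≤ 2 ^ L
  r≤ = ℕ.≤-trans (ℕ.m≤n+m r (2 * (L * m))) n≤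
  go : ∀ es → edges G ≡ es → InitLast es →
       Σ (EdgeOrderedGraph (2 * (L * m) + r)) λ H →
         Semisaturated G H × edgeCount H ≤ 2 * (L * m) * (2 * (L * m) + r)
  go []             G≡ _ = contradiction (subst (1 ≤_) (cong length G≡) G≥1) λ ()
  -- The list is split at its end to obtain `last`, while `eq` retains the split at its head.
  go (first ∷ rest) G≡ il with first ∷ rest in eq | il
  ... | _ | init ∷ʳ′ last =
    _ , semisaturated G {init} {rest} {last} {first} G≡ (trans G≡ (sym eq)) L r (binary r≤)
          (binary-separating r≤)
      , Construction.H-edgeCount (edges G) _ L r (binary r≤)

corollary11 : ∀ {m : ℕ} (G : EdgeOrderedGraph m) → edgeCount G ≥ 1 →
    (λ n → ssat n G) =O (λ n → n * ⌊log₂ n ⌋)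
-- With `l = ⌊log₂ n ⌋` the codes have length `suc l`; from `n ≥ 2` on, `suc l ≤ l + l`, and the
-- doubling turns the factor 2 into 4.
corollary11 {m} G G≥1 = 4 * m , 2 , bound
  where
  rearrange : ∀ l m n → 2 * ((l + l) * m) * n ≡ 4 * m * (n * l)
  rearrange = solve-∀
  bound : ∀ n → n ≥ 2 → ssat n G ≤ 4 * m * (n * ⌊log₂ n ⌋)
  bound n n≥2 with sparse-semisaturated G G≥1 n (suc ⌊log₂ n ⌋) (n≤2^[1+⌊log₂n⌋] n)
  ... | H , sat , H≤ = begin
    ssat n G                          ≤⟨ proj₂ (ssat-isLeast n G) (edgeCount H) (H , sat , refl) ⟩
    edgeCount H                       ≤⟨ H≤ ⟩
    2 * (suc l * m) * n               ≤⟨ ℕ.*-monoˡ-≤ n (ℕ.*-monoʳ-≤ 2 (ℕ.*-monoˡ-≤ m (ℕ.+-monoˡ-≤ l 1≤l))) ⟩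
    2 * ((l + l) * m) * n             ≡⟨ rearrange l m n ⟩
    4 * m * (n * l)                   ∎
    where
    open ℕ.≤-Reasoning
    l = ⌊log₂ n ⌋
    1≤l : 1 ≤ l
    1≤l = ⌊log₂⌋-mono-≤ n≥2
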